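{- Let $G$ be a 3-connected 1-heavy graph on $n\geq 3$ vertices. Suppose that for every induced subgraph $H$ of $G$ isomorphic to $Z_1$ and every pair of vertices $u,v\in V(H)$ with $d_H(u,v)=2$, we have $\max\{d(u),d(v)\}\geq n/2$ or $|N(u)\cap N(v)|\geq 2$. Then $G$ is Hamiltonian.
   Context: All graphs are finite and simple; $d(x)$ and $N(x)$ denote the degree and neighborhood of $x$ in $G$, and $d_H(u,v)$ is the distance between $u$ and $v$ in $H$. A vertex of $G$ is heavy if its degree is at least $n/2$. A claw is $K_{1,3}$; its degree-3 vertex is the center and the other three are end-vertices. $G$ is 1-heavy if every induced claw of $G$ has at least one heavy end-vertex. $Z_1$ is the graph obtained from a triangle by attaching a pendant edge to one vertex of the triangle. -}

module Defs where

open import Data.Nat using (ℕ; zero; suc; _+_; _*_; _≤_; _<_)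
open import Data.Bool using (Bool; true; false; if_then_else_; _∧_)
open import Data.Fin using (Fin; toℕ)
open import Data.Fin.Subset using (Subset; _∈_; _∉_; ∣_∣)
open import Data.List using (List; map; allFin)
open import Data.Nat.ListAction using (sum)
open import Data.Product using (Σ; ∃; _×_; _,_)
open import Data.Sum using (_⊎_)
open import Relation.Nullary using (¬_)
open import Relation.Binary.PropositionalEquality using (_≡_)
open import Function.Definitions using (Injective)

record Graph (n : ℕ) : Set where
  field
    E      : Fin n → Fin n → Bool
    sym    : ∀ u v → E u v ≡ E v u
    irrefl : ∀ u → E u u ≡ false

open Graph public

module _ {n : ℕ} (G : Graph n) where

  Adj : Fin n → Fin n → Set
  Adj u v = E G u v ≡ true

  degree : Fin n → ℕ
  degree x = sum (map (λ y → if E G x y then 1 else 0) (allFin n))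

  commonNbrs : Fin n → Fin n → ℕ
  commonNbrs u v = sum (map (λ y → if E G u y ∧ E G v y then 1 else 0) (allFin n))

  Heavy : Fin n → Set
  Heavy x = n ≤ 2 * degree x

  InducedClaw : Fin n → Fin n → Fin n → Fin n → Set
  InducedClaw c a b d =
    Adj c a × Adj c b × Adj c d ×
    ¬ a ≡ b × ¬ a ≡ d × ¬ b ≡ d ×
    ¬ Adj a b × ¬ Adj a d × ¬ Adj b d

  OneHeavy : Set
  OneHeavy = ∀ c a b d → InducedClaw c a b d → Heavy a ⊎ Heavy b ⊎ Heavy d

  -- induced Z1: triangle a b c with pendant edge d a (d nonadjacent to b, c).
  -- (All four vertices are automatically distinct.)
  InducedZ1 : Fin n → Fin n → Fin n → Fin n → Set
  InducedZ1 a b c d =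
    Adj a b × Adj b c × Adj a c × Adj d a × ¬ Adj d b × ¬ Adj d c

  PairCond : Fin n → Fin n → Set
  PairCond u v = (Heavy u ⊎ Heavy v) ⊎ 2 ≤ commonNbrs u v

  data Reach (S : Subset n) : Fin n → Fin n → Set where
    here : ∀ {u} → u ∉ S → Reach S u u
    step : ∀ {u w v} → u ∉ S → Adj u w → Reach S w v → Reach S u v

  Connected : ℕ → Set
  Connected k = k < n × (∀ (S : Subset n) → ∣ S ∣ < k →
                  ∀ u v → u ∉ S → v ∉ S → Reach S u v)

  -- Hamiltonian: a cyclic ordering σ of all vertices (σ injective, hence a
  -- bijection) with consecutive vertices adjacent, including the last and first.
  Hamiltonian : Set
  Hamiltonian = Σ (Fin n → Fin n) λ σ → Injective _≡_ _≡_ σ ×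
    (∀ i j → toℕ j ≡ suc (toℕ i) → Adj (σ i) (σ j)) ×
    (∀ i j → toℕ i ≡ 0 → suc (toℕ j) ≡ n → Adj (σ j) (σ i))

{-# OPTIONS --safe #-}
module Submission where

-- Let two heavy vertices count as linked even when they are not adjacent. By the
-- Bondy–Chvátal exchange a Hamiltonian cycle of links yields one of edges, so
-- take a longest cycle c of links through all heavy vertices and suppose that y
-- lies outside it; y is not heavy. Write a⁺ and a⁻ for the neighbours of a on c.
-- Distinct attachments a, b of the component of y have a⁺, b⁺ unlinked, and so
-- have a⁻, b⁻. Hence at most one a⁺ and at most one a⁻ is heavy, and among three
-- attachments some w has w⁺ and w⁻ light. Renaming y to a neighbour of w in the
-- component, the claw condition gives w⁺ ~ w⁻, and Z₁ gives a second common
-- neighbour j of y and w⁺; the claw at j makes j⁺ heavy, and then j⁻ is light,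
-- adjacent to w⁺, and shares a second neighbour with y. Symmetrically there is l
-- with l⁻ heavy, l⁺ light and a second common neighbour m of y and l⁺, with m⁺
-- heavy. Then m = j, and j is the centre of a claw with light ends w⁺, l⁺, y.

open import Defs
open import Data.Bool using (Bool; true; false; if_then_else_; _∧_)
import Data.Bool as Bool
open import Data.Empty using (⊥)
open import Data.Fin using (Fin; toℕ; cast)
import Data.Fin as Fin
open import Data.Fin.Properties using (toℕ-cast; toℕ-injective; all?; any?)
open import Data.Fin.Subset using (Subset; ⁅_⁆; _∪_; ∣_∣; inside; outside)
  renaming (_∉_ to _∉ˢ_)
open import Data.Fin.Subset.Properties using (∣⁅x⁆∣≡1; x∈⁅y⁆⇒x≡y; x∈p∪q⁻; x∈p∪q⁺; x∈⁅x⁆)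
open import Data.List using (List; []; _∷_; [_]; _++_; _∷ʳ_; map; length; lookup; allFin; filter;
  initLast; _∷ʳ′_)
open import Data.List.Properties using (++-assoc; ++-identityʳ; ∷-injectiveˡ; ∷-injectiveʳ;
  ∷ʳ-injectiveʳ; length-++; length-tabulate)
open import Data.List.Membership.Propositional using (_∈_; _∉_)
open import Data.List.Membership.Propositional.Properties using (∈-++⁺ˡ; ∈-++⁺ʳ; ∈-∃++; ∈-insert;
  ∈-lookup; ∈-allFin; ∈-filter⁺; ∈-filter⁻)
open import Data.List.Relation.Unary.Any using (here; there; tail)
open import Data.List.Relation.Unary.All using (All; []; _∷_)
import Data.List.Relation.Unary.All as All
open import Data.List.Relation.Unary.AllPairs using ([]; _∷_)
open import Data.List.Relation.Unary.Unique.Propositional using (Unique)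
import Data.List.Relation.Unary.Unique.Propositional.Properties as Unique
open import Data.List.Relation.Binary.Permutation.Propositional using (_↭_; ↭-refl; ↭-sym; ↭-trans;
  ↭-reflexive; prep; ↭⇒↭ₛ)
open import Data.List.Relation.Binary.Permutation.Propositional.Properties using (++-comm; ++⁺;
  ++⁺ˡ; map⁺; ↭-length; shifts; shift; ∈-resp-↭)
import Data.List.Relation.Binary.Permutation.Setoid.Properties as Permutationₛ
open import Data.Nat using (ℕ; zero; suc; _+_; _*_; _≤_; _<_; z≤n; s≤s)
open import Data.Nat.Properties using (*-cancelˡ-≤; *-distribˡ-+; +-assoc; +-comm; +-identityʳ;
  +-mono-≤; +-monoʳ-≤; +-monoˡ-≤; +-suc; <⇒≤; <⇒≱; _≟_; m+n≡0⇒n≡0; m≤m+n; m≤n+m; n≤1+n; suc-injective;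
  ≤-refl; ≤-reflexive; ≤-trans; ≮⇒≥; _≤?_; module ≤-Reasoning)
open import Data.Nat.ListAction using (sum)
open import Data.Nat.ListAction.Properties using (sum-↭)
open import Data.Nat.Tactic.RingSolver using (solve-∀)
open import Data.Product using (∃; ∃₂; _×_; _,_; proj₁; proj₂)
open import Data.Sum using (_⊎_; inj₁; inj₂; [_,_]′)
open import Data.Vec using (Vec; []; _∷_)
import Data.Vec as Vec
open import Data.Vec.Properties using (lookup∘tabulate)
open import Function using (_∘_)
open import Function.Definitions using (Injective)
open import Relation.Nullary using (¬_; Dec; yes; no; contradiction)
open import Relation.Nullary.Decidable using (map′; _×-dec_; _→-dec_; decidable-stable)
open import Relation.Binary.PropositionalEquality using (_≡_; _≢_; refl; cong; cong₂; subst; subst₂;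
  trans)
import Relation.Binary.PropositionalEquality as ≡

Unique-resp-↭ : {A : Set} {l m : List A} → l ↭ m → Unique l → Unique m
Unique-resp-↭ p = Permutationₛ.Unique-resp-↭ (≡.setoid _) (↭⇒↭ₛ p)

-- Cyclic lists

-- Generated by single turns, so that a property of lists is invariant under rotation once it
-- survives one `turn`.
data Rotation {A : Set} (c : List A) : List A → Set where
  done : Rotation c c
  turn : ∀ {x xs} → Rotation c (x ∷ xs) → Rotation c (xs ∷ʳ x)

module _ {A : Set} where

  rotate : (P : List A → Set) → (∀ {x xs} → P (x ∷ xs) → P (xs ∷ʳ x)) →
           ∀ {c d} → Rotation c d → P c → P d
  rotate P inv done     p = p
  rotate P inv (turn r) p = inv (rotate P inv r p)

  rotation-++ : ∀ {c : List A} X {Y} → Rotation c (X ++ Y) → Rotation c (Y ++ X)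
  rotation-++ []      r = subst (Rotation _) (≡.sym (++-identityʳ _)) r
  rotation-++ (x ∷ X) {Y} r = subst (Rotation _) (++-assoc Y [ x ] X)
    (rotation-++ X (subst (Rotation _) (++-assoc X Y [ x ]) (turn r)))

  rotation⇒↭ : ∀ {c d : List A} → Rotation c d → d ↭ c
  rotation⇒↭ done     = ↭-refl
  rotation⇒↭ (turn {x} {xs} r) = ↭-trans (++-comm xs [ x ]) (rotation⇒↭ r)

  data Next (c : List A) (a b : A) : Set where
    inside : ∀ X Y → c ≡ X ++ a ∷ b ∷ Y → Next c a b
    around : ∀ X → c ≡ b ∷ X ∷ʳ a → Next c a b

  next-turn : ∀ {x xs a b} → Next (x ∷ xs) a b → Next (xs ∷ʳ x) a b
  next-turn (inside []      Y refl) = around Y refl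
  next-turn {x} {a = a} {b} (inside (_ ∷ X) Y refl) = inside X (Y ∷ʳ x) (++-assoc X (a ∷ b ∷ Y) [ x ])
  next-turn {a = a} {b} (around X refl) = inside X [] (++-assoc X [ a ] [ b ])

  -- Opening the cycle between `a` and `b` puts `b` first and `a` last, so that questions about
  -- successors become questions about the two ends of a list.
  align : ∀ {c a b} → Next c a b → ∃ λ Z → Rotation c (b ∷ Z ∷ʳ a)
  align {c} {a} {b} (inside X Y refl) = Y ++ X ,
    subst (Rotation c) (≡.sym (cong (b ∷_) (++-assoc Y X [ a ])))
      (rotation-++ (X ∷ʳ a) (subst (Rotation c) (≡.sym (++-assoc X [ a ] (b ∷ Y))) done))
  align (around X refl) = X , done

  next-∈ˡ : ∀ {c a b} → Next c a b → a ∈ c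
  next-∈ˡ (inside X Y refl) = ∈-insert X
  next-∈ˡ (around X refl)   = there (∈-++⁺ʳ X (here refl))

  next-∈ʳ : ∀ {c a b} → Next c a b → b ∈ c
  next-∈ʳ (inside X Y refl) = ∈-++⁺ʳ X (there (here refl))
  next-∈ʳ (around X refl)   = here refl

  successor : ∀ {c v} → 2 ≤ length c → v ∈ c → ∃ (Next c v)
  successor 2≤ v∈c with ∈-∃++ v∈c
  ... | X , b ∷ Y , refl = b , inside X Y refl
  ... | b ∷ X , [] , refl = b , around X refl
  successor (s≤s ()) _ | [] , [] , refl

  predecessor : ∀ {c v} → 2 ≤ length c → v ∈ c → ∃ λ a → Next c a v
  predecessor 2≤ v∈c with ∈-∃++ v∈c
  ... | X , Y , refl with initLast X | initLast Y
  ... | X′ ∷ʳ′ a | _ = a , inside X′ Y (++-assoc X′ [ a ] _)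
  ... | [] | Y′ ∷ʳ′ a = a , around Y′ refl
  predecessor (s≤s ()) v∈c | .[] , .[] , refl | [] | []

  head∉tail : ∀ {x : A} {xs} → Unique (x ∷ xs) → x ∉ xs
  head∉tail (x≢ ∷ _) x∈ = All.lookup x≢ x∈ refl

  last-terminal : ∀ (W : List A) {a b X Y} → Unique (W ∷ʳ a) → W ∷ʳ a ≢ X ++ a ∷ b ∷ Y
  last-terminal [] {X = []} u ()
  last-terminal [] {X = _ ∷ []} u ()
  last-terminal [] {X = _ ∷ _ ∷ _} u ()
  last-terminal (w ∷ W) {X = []} u eq = head∉tail u
    (subst (_∈ W ∷ʳ _) (≡.sym (∷-injectiveˡ eq)) (∈-++⁺ʳ W (here refl)))
  last-terminal (w ∷ W) {X = x ∷ X} (_ ∷ u) eq = last-terminal W u (∷-injectiveʳ eq)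

  head-initial : ∀ {b : A} {Z a X Y} → Unique (b ∷ Z) → b ∷ Z ≢ X ++ a ∷ b ∷ Y
  head-initial {X = []} u refl = head∉tail u (here refl)
  head-initial {X = x ∷ X} u refl = head∉tail u (∈-++⁺ʳ X (there (here refl)))

  module _ {c : List A} (u : Unique c) where

    private
      next-rotate : ∀ {d} → Rotation c d → ∀ {a b} → Next c a b → Next d a b
      next-rotate r {a} {b} = rotate (λ l → Next l a b) next-turn r

      rotated : ∀ {d} → Rotation c d → Unique d
      rotated r = Unique-resp-↭ (↭-sym (rotation⇒↭ r)) u

    -- With `a` last in the rotated list, another pair starting at `a` can only be the one that
    -- wraps around.
    next-functional : ∀ {a b b′} → Next c a b → Next c a b′ → b ≡ b′
    next-functional {a} {b} p q with align p
    ... | Z , r with next-rotate r q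
    ... | inside X Y eq = contradiction eq (last-terminal (b ∷ Z) (rotated r))
    ... | around X eq   = ∷-injectiveˡ eq

    next-injective : ∀ {a a′ b} → Next c a b → Next c a′ b → a ≡ a′
    next-injective {a} {a′} {b} p q with align p
    ... | Z , r with next-rotate r q
    ... | inside X Y eq = contradiction eq (head-initial (rotated r))
    ... | around X eq   = ∷ʳ-injectiveʳ Z X (∷-injectiveʳ eq)

    -- In a cycle of two entries each follows the other. With a third entry between `b` at the front
    -- and `a` at the end of the rotated list, an `a` directly after `b` would be a repetition.
    next-asym : 3 ≤ length c → ∀ {a b} → Next c a b → ¬ Next c b a
    next-asym 3≤ {a} {b} p q with align p
    ... | Z , r with next-rotate r q | rotated r
    ... | around X eq | u′ = head∉tail u′
          (subst (_∈ Z ∷ʳ a) (≡.sym (∷-injectiveˡ eq)) (∈-++⁺ʳ Z (here refl)))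
    ... | inside (x ∷ X) Y eq | u′ = head∉tail u′
          (subst (_∈ Z ∷ʳ a) (≡.sym (∷-injectiveˡ eq))
            (subst (x ∈_) (≡.sym (∷-injectiveʳ eq))
              (subst (_∈ X ++ b ∷ a ∷ Y) (∷-injectiveˡ eq) (∈-insert X))))
    next-asym 3≤ {a} {b} p q | [] , r | inside [] Y eq | u′
      with subst (3 ≤_) (≡.sym (↭-length (rotation⇒↭ r))) 3≤
    ... | s≤s (s≤s ())
    next-asym 3≤ {a} {b} p q | z ∷ Z , r | inside [] Y eq | _ ∷ u′ =
      head∉tail u′ (subst (_∈ Z ∷ʳ a) (≡.sym (∷-injectiveˡ (∷-injectiveʳ eq))) (∈-++⁺ʳ Z (here refl)))

-- The index of a path counts its steps between heavy vertices that need not be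
-- edges of G.

module Paths {n : ℕ} (G : Graph n) where

  V : Set
  V = Fin n

  data Step : ℕ → V → V → Set where
    edge  : ∀ {x y} → Adj G x y → Step 0 x y
    jump  : ∀ {x y} → Heavy G x → Heavy G y → x ≢ y → Step 1 x y

  data Path : ℕ → V → V → List V → Set where
    [-] : ∀ {x} → Path 0 x x [ x ]
    _∷_ : ∀ {j k x y z l} → Step j x z → Path k z y l → Path (j + k) x y (x ∷ l)

  adj-sym : ∀ {x y} → Adj G x y → Adj G y x
  adj-sym {x} {y} e = trans (Graph.sym G y x) e

  step-sym : ∀ {j x y} → Step j x y → Step j y x
  step-sym (edge e)      = edge (adj-sym e)
  step-sym (jump p q x≢y) = jump q p (λ eq → x≢y (≡.sym eq))

  append : ∀ {j k k′ x y z w l m} → Path k x y l → Step j y z → Path k′ z w m →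
           Path (k + (j + k′)) x w (l ++ m)
  append [-]     t q = t ∷ q
  append {j} {k′ = k′} {x = x} {w = w} {m = m} (_∷_ {i} {k} {l = l} s p) t q =
    subst (λ i → Path i x w (x ∷ l ++ m)) (≡.sym (+-assoc i k (j + k′))) (s ∷ append p t q)

  split : ∀ {k x y a b} X {Y} → Path k x y (X ++ a ∷ b ∷ Y) → ∃₂ λ i j → ∃ λ k′ →
          Path i x a (X ∷ʳ a) × Step j a b × Path k′ b y (b ∷ Y)
  split [] (s ∷ p@[-])     = _ , _ , _ , [-] , s , p
  split [] (s ∷ p@(_ ∷ _)) = _ , _ , _ , [-] , s , p
  split (_ ∷ []) (s ∷ p) with split [] p
  ... | _ , _ , _ , p₁ , t , p₂ = _ , _ , _ , s ∷ p₁ , t , p₂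
  split (_ ∷ X@(_ ∷ _)) (s ∷ p) with split X p
  ... | _ , _ , _ , p₁ , t , p₂ = _ , _ , _ , s ∷ p₁ , t , p₂

  path-head : ∀ {k x y z l} → Path k x y (z ∷ l) → x ≡ z
  path-head [-]     = refl
  path-head (s ∷ p) = refl

  path-last : ∀ {k x y z} l → Path k x y (l ∷ʳ z) → y ≡ z
  path-last []          [-]      = refl
  path-last (_ ∷ [])    (s ∷ p)  = path-last [] p
  path-last (_ ∷ l@(_ ∷ _)) (s ∷ p) = path-last l p

  -- Exchanges cut, reverse and reassemble paths; only the ends, the number of jumps and the
  -- multiset of visited vertices have to be tracked.
  record Trail (k : ℕ) (x y : V) (l : List V) : Set where
    constructor trail
    field
      {order} : List V
      path    : Path k x y order
      bag     : order ↭ l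

  ⟨_⟩ : ∀ {k x y l} → Path k x y l → Trail k x y l
  ⟨ p ⟩ = trail p ↭-refl

  reorder : ∀ {k x y l m} → l ↭ m → Trail k x y l → Trail k x y m
  reorder q (trail p b) = trail p (↭-trans b q)

  appendᵗ : ∀ {j k k′ x y z w l m} → Trail k x y l → Step j y z → Trail k′ z w m →
            Trail (k + (j + k′)) x w (l ++ m)
  appendᵗ (trail p b) s (trail q c) = trail (append p s q) (++⁺ b c)

  reverse-path : ∀ {k x y l} → Path k x y l → Trail k y x l
  reverse-path [-] = ⟨ [-] ⟩
  reverse-path {x = x} {y} (_∷_ {j} {k} {l = l} s p) =
    reorder (++-comm l [ x ]) (subst (λ i → Trail i y x (l ∷ʳ x))
      (trans (cong (k +_) (+-identityʳ j)) (+-comm k j))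
      (appendᵗ (reverse-path p) (step-sym s) ⟨ [-] ⟩))

  reverseᵗ : ∀ {k x y l} → Trail k x y l → Trail k y x l
  reverseᵗ (trail p b) = reorder b (reverse-path p)

  -- The Bondy–Chvátal exchange

  indicator : Bool → ℕ
  indicator b = if b then 1 else 0

  count : (V → Bool) → List V → ℕ
  count f l = sum (map (λ v → indicator (f v)) l)

  count-↭ : ∀ f {l m} → l ↭ m → count f l ≡ count f m
  count-↭ f p = sum-↭ (map⁺ _ p)

  both-or-≤1 : ∀ a b → (a ≡ true × b ≡ true) ⊎ (indicator a + indicator b ≤ 1)
  both-or-≤1 true  true  = inj₁ (refl , refl)
  both-or-≤1 true  false = inj₂ ≤-refl
  both-or-≤1 false true  = inj₂ ≤-refl
  both-or-≤1 false false = inj₂ z≤n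

  -- When no step p q of the path has both g p and f q, every step contributes at
  -- most 1 to the two counts; f at the start and g at the end belong to no step.
  crossing : ∀ (f g : V → Bool) {k x y l} → Path k x y l →
    (∃₂ λ p q → ∃₂ λ i j → ∃ λ k′ → ∃₂ λ X Y →
       Path i x p X × Step j p q × Path k′ q y Y × (i + k′ ≤ k) × (X ++ Y ≡ l) ×
       g p ≡ true × f q ≡ true)
    ⊎ (suc (count f l + count g l) ≤ length l + (indicator (f x) + indicator (g y)))
  crossing f g ([-] {x}) = inj₂ (≤-reflexive (lemma (indicator (f x)) (indicator (g x))))
    where
    lemma : ∀ a b → suc ((a + 0) + (b + 0)) ≡ 1 + (a + b)
    lemma = solve-∀
  crossing f g {x = x} {y} (_∷_ {j} {k} {z = z} {l} s p) with both-or-≤1 (g x) (f z) | crossing f g p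
  ... | inj₁ (gx , fz) | _ =
    inj₁ (x , z , _ , j , k , [ x ] , _ , [-] , s , p , m≤n+m k j , refl , gx , fz)
  ... | inj₂ _ | inj₁ (a , b , i , i′ , k′ , X , Y , p₁ , t , p₂ , le , eq , ga , fb) =
    inj₁ (a , b , j + i , i′ , k′ , _ ∷ X , Y , s ∷ p₁ , t , p₂ ,
      ≤-trans (≤-reflexive (+-assoc j i k′)) (+-monoʳ-≤ j le) , cong (_ ∷_) eq , ga , fb)
  ... | inj₂ gx+fz≤1 | inj₂ le = inj₂ (begin
    suc ((fx + F) + (gx + H))     ≡⟨ lhs fx F gx H ⟩
    (fx + gx) + suc (F + H)       ≤⟨ +-monoʳ-≤ (fx + gx) le ⟩
    (fx + gx) + (L + (fz + gy))   ≡⟨ rhs fx gx L fz gy ⟩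
    (L + (fx + gy)) + (gx + fz)   ≤⟨ +-monoʳ-≤ (L + (fx + gy)) gx+fz≤1 ⟩
    (L + (fx + gy)) + 1           ≡⟨ +-comm (L + (fx + gy)) 1 ⟩
    suc L + (fx + gy)             ∎)
    where
    open ≤-Reasoning
    fx = indicator (f x)
    gx = indicator (g x)
    fz = indicator (f z)
    gy = indicator (g y)
    F = count f l
    H = count g l
    L = length l
    lhs : ∀ a b c d → suc ((a + b) + (c + d)) ≡ (a + c) + suc (b + d)
    lhs = solve-∀
    rhs : ∀ a b c d e → (a + b) + (c + (d + e)) ≡ (c + (a + e)) + (b + d)
    rhs = solve-∀

  HamiltonianPathCycle : Set
  HamiltonianPathCycle = ∃₂ λ x y → Trail 0 x y (allFin n) × Adj G y x

  heavy-degrees : ∀ {x y} → Heavy G x → Heavy G y → n ≤ degree G x + degree G y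
  heavy-degrees {x} {y} hx hy = *-cancelˡ-≤ 2 (begin
    2 * n                             ≡⟨ cong (n +_) (+-identityʳ n) ⟩
    n + n                             ≤⟨ +-mono-≤ hx hy ⟩
    2 * degree G x + 2 * degree G y   ≡⟨ *-distribˡ-+ 2 (degree G x) (degree G y) ⟨
    2 * (degree G x + degree G y)     ∎)
    where open ≤-Reasoning

  -- The degrees of `x` and `y` sum to at least `n`, which exceeds the counting bound of `crossing`.
  -- So some step from `p` to `q` has `y` adjacent to `p` and `x` adjacent to `q`; the order
  -- `p … x q … y` closes up by an edge, and a step is traded for an edge, which adds no jump.
  bondy-chvátal : ∀ {k x y} → Trail k x y (allFin n) → Heavy G x → Heavy G y →
    ∃₂ λ u v → ∃ λ k′ → k′ ≤ k × Trail k′ u v (allFin n) × Adj G v u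
  bondy-chvátal {x = x} {y} (trail {l} path b) hx hy with crossing (E G x) (E G y) path
  ... | inj₁ (p , q , i , j , k′ , X , Y , p₁ , t , p₂ , le , refl , yp , xq) =
    p , y , _ , le ,
    reorder b (appendᵗ (reverse-path p₁) (edge xq) ⟨ p₂ ⟩) ,
    yp
  ... | inj₂ le = contradiction (heavy-degrees hx hy) (<⇒≱ (begin-strict
    degree G x + degree G y           ≡⟨ cong₂ _+_ (count-↭ (E G x) b) (count-↭ (E G y) b) ⟨
    count (E G x) l + count (E G y) l <⟨ le ⟩
    -- No vertex is adjacent to itself, so the corrections for the two ends vanish.
    length l + (indicator (E G x x) + indicator (E G y y))
      ≡⟨ cong₂ (λ s t → length l + (indicator s + indicator t)) (irrefl G x) (irrefl G y) ⟩
    length l + 0                      ≡⟨ +-identityʳ _ ⟩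
    length l                          ≡⟨ trans (↭-length b) (length-tabulate _) ⟩
    n                                 ∎))
    where open ≤-Reasoning

  find-jump : ∀ {k m x y l} → Path m x y l → m ≡ suc k →
    ∃₂ λ p q → ∃₂ λ i j → ∃₂ λ X Y →
      Path i x p X × Step 1 p q × Path j q y Y × i + j ≡ k × X ++ Y ≡ l
  find-jump [-] ()
  find-jump (s@(jump _ _ _) ∷ p) refl = _ , _ , 0 , _ , _ , _ , [-] , s , p , refl , refl
  find-jump (s@(edge _) ∷ p) eq with find-jump p eq
  ... | a , b , i , j , X , Y , p₁ , t , p₂ , sum≡ , refl =
    a , b , i , j , _ , _ , s ∷ p₁ , t , p₂ , sum≡ , refl

  -- Reopening the cycle at a jump from `p` to `q` gives a path `q … y x … p` with heavy ends and
  -- one jump fewer. The exchange closes it by an edge without new jumps, so the bound `m` drops.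
  eliminate-jumps : ∀ m {k x y} → k ≤ m → Trail k x y (allFin n) → Adj G y x → HamiltonianPathCycle
  eliminate-jumps m {zero} _ t e = _ , _ , t , e
  eliminate-jumps (suc m) {suc k} (s≤s k≤m) (trail path b) e with find-jump path refl
  ... | p , q , i , j , X , Y , p₁ , jump hp hq _ , p₂ , refl , refl
    with bondy-chvátal (reorder (↭-trans (++-comm Y X) b) ⟨ append p₂ (edge e) p₁ ⟩) hq hp
  ... | u , v , k′ , k′≤ , t , e′ =
    eliminate-jumps m (≤-trans k′≤ (≤-trans (≤-reflexive (+-comm j i)) k≤m)) t e′

  hamiltonian-closure : ∀ {j k x y} → Trail k x y (allFin n) → Step j y x → HamiltonianPathCycle
  hamiltonian-closure t (edge e) = eliminate-jumps _ ≤-refl t e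
  hamiltonian-closure t (jump hy hx _) with bondy-chvátal t hx hy
  ... | _ , _ , k , _ , t′ , e = eliminate-jumps k ≤-refl t′ e

-- Links, chains and cyclic orderings

module Cycles {n : ℕ} (G : Graph n) where

  open Paths G public
  open import Data.List.Membership.DecPropositional (Fin._≟_ {n}) using (_∈?_) public

  adj? : ∀ x y → Dec (Adj G x y)
  adj? x y = E G x y Bool.≟ true

  heavy? : ∀ x → Dec (Heavy G x)
  heavy? x = n ≤? 2 * degree G x

  Link : V → V → Set
  Link x y = ∃ λ j → Step j x y

  link : ∀ {x y} → Adj G x y → Link x y
  link e = _ , edge e

  link-sym : ∀ {x y} → Link x y → Link y x
  link-sym (j , s) = j , step-sym s

  Chain : V → V → List V → Set
  Chain x y l = ∃ λ k → Trail k x y l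

  infixr 5 _⟪_⟫_
  _⟪_⟫_ : ∀ {x y z w l m} → Chain x y l → Link y z → Chain z w m → Chain x w (l ++ m)
  (_ , t) ⟪ _ , s ⟫ (_ , u) = _ , appendᵗ t s u

  single : ∀ {x} → Chain x x [ x ]
  single = _ , ⟨ [-] ⟩

  chain-reverse : ∀ {x y l} → Chain x y l → Chain y x l
  chain-reverse (k , t) = k , reverseᵗ t

  chain-reorder : ∀ {x y l m} → l ↭ m → Chain x y l → Chain x y m
  chain-reorder p (k , t) = k , reorder p t

  -- The relation N is the successor relation of a cyclic ordering of c; only
  -- facts that survive reversing the orientation are recorded.
  record Cyclic (c : List V) : Set₁ where
    field
      N          : V → V → Set
      next       : ∀ {v} → v ∈ c → ∃ λ w → N v w
      prev       : ∀ {v} → v ∈ c → ∃ λ u → N u v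
      source-∈   : ∀ {a b} → N a b → a ∈ c
      target-∈   : ∀ {a b} → N a b → b ∈ c
      functional : ∀ {a b b′} → N a b → N a b′ → b ≡ b′
      injective  : ∀ {a a′ b} → N a b → N a′ b → a ≡ a′
      asym       : ∀ {a b} → N a b → ¬ N b a
      linked     : ∀ {a b} → N a b → Link a b
      cut        : ∀ {a b} → N a b → Chain b a c
      cut₂       : ∀ {a a′ b b′} → N a a′ → N b b′ → a ≢ b → a′ ≢ b′ →
                   ∃₂ λ A B → Chain a′ b A × Chain b′ a B × A ++ B ↭ c
      excise     : ∀ {a a′ b⁻ b b⁺} → N a a′ → N b⁻ b → N b b⁺ → a ≢ b → a′ ≢ b →
                   ∃₂ λ A B → Chain a′ b⁻ A × Chain b⁺ a B × b ∷ A ++ B ↭ c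

  -- Whatever is proved about successors for every `Cyclic c` thereby holds for predecessors.
  opposite : ∀ {c} → Cyclic c → Cyclic c
  opposite {c} C = record
    { N          = λ a b → N b a
    ; next       = prev
    ; prev       = next
    ; source-∈   = target-∈
    ; target-∈   = source-∈
    ; functional = injective
    ; injective  = functional
    ; asym       = λ p q → asym p q
    ; linked     = λ p → link-sym (linked p)
    ; cut        = λ p → chain-reverse (cut p)
    ; cut₂       = λ p q a≢b a′≢b′ →
        let A , B , s , t , r = cut₂ p q a′≢b′ a≢b
        in  B , A , chain-reverse t , chain-reverse s , ↭-trans (++-comm B A) r
    ; excise     = λ p q r a≢b a′≢b →
        let A , B , s , t , σ = excise p r q a′≢b a≢b
        in  B , A , chain-reverse t , chain-reverse s , ↭-trans (prep _ (++-comm B A)) σ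
    }
    where open Cyclic C

  ClosedPath : List V → Set
  ClosedPath c = ∃₂ λ x y → (∃ λ k → Path k x y c) × Link y x

  -- The old closing link becomes the last step, and the first step becomes the closing link.
  closed-turn : ∀ {v xs} → ClosedPath (v ∷ xs) → ClosedPath (xs ∷ʳ v)
  closed-turn (x , y , (k , [-]) , s) = x , y , (k , [-]) , s
  closed-turn (x , y , (_ , s ∷ p) , (_ , t)) = _ , _ , (_ , append p t [-]) , (_ , s)

  private
    closed-ends : ∀ {a b} Z → ClosedPath (b ∷ Z ∷ʳ a) → (∃ λ k → Path k b a (b ∷ Z ∷ʳ a)) × Link a b
    closed-ends {b = b} Z (x , y , (k , p) , s)
      with refl ← path-head p | refl ← path-last (b ∷ Z) p = (k , p) , s

    to-chain : ∀ {k x y l} → Path k x y l → Chain x y l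
    to-chain p = _ , ⟨ p ⟩

  cyclic : ∀ {c} → 3 ≤ length c → Unique c → ClosedPath c → Cyclic c
  cyclic {c} 3≤ u closed = record
    { N          = Next c
    ; next       = successor (≤-trans (n≤1+n 2) 3≤)
    ; prev       = predecessor (≤-trans (n≤1+n 2) 3≤)
    ; source-∈   = next-∈ˡ
    ; target-∈   = next-∈ʳ
    ; functional = next-functional u
    ; injective  = next-injective u
    ; asym       = next-asym u 3≤
    ; linked     = λ p → proj₂ (proj₂ (proj₂ (opened p)))
    ; cut        = λ p → let Z , r , (_ , q) , _ = opened p
                         in  chain-reorder (rotation⇒↭ r) (to-chain q)
    ; cut₂       = cut₂
    ; excise     = excise
    }
    where
    opened : ∀ {a b} → Next c a b → ∃ λ Z → Rotation c (b ∷ Z ∷ʳ a) ×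
             (∃ λ k → Path k b a (b ∷ Z ∷ʳ a)) × Link a b
    opened p with Z , r ← align p = Z , r , closed-ends Z (rotate ClosedPath closed-turn r closed)

    carry : ∀ {d a b} → Rotation c d → Next c a b → Next d a b
    carry {a = a} {b} = rotate (λ l → Next l a b) next-turn

    cut₂ : ∀ {a a′ b b′} → Next c a a′ → Next c b b′ → a ≢ b → a′ ≢ b′ →
           ∃₂ λ A B → Chain a′ b A × Chain b′ a B × A ++ B ↭ c
    cut₂ {a} {a′} {b} {b′} p q a≢b a′≢b′ with opened p
    ... | Z , r , (k , path) , _ with carry r q
    ... | around X eq = contradiction (∷-injectiveˡ eq) a′≢b′
    ... | inside X Y eq with split X (subst (Path k a′ a) eq path)
    ... | _ , _ , _ , p₁ , _ , p₂ = X ∷ʳ b , b′ ∷ Y , to-chain p₁ , to-chain p₂ ,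
      ↭-trans (↭-reflexive (trans (++-assoc X [ b ] (b′ ∷ Y)) (≡.sym eq))) (rotation⇒↭ r)

    excise : ∀ {a a′ b⁻ b b⁺} → Next c a a′ → Next c b⁻ b → Next c b b⁺ → a ≢ b → a′ ≢ b →
             ∃₂ λ A B → Chain a′ b⁻ A × Chain b⁺ a B × b ∷ A ++ B ↭ c
    excise {a} {a′} {b⁻} {b} {b⁺} p q s a≢b a′≢b with opened p
    ... | Z , r , (k , path) , _ with carry r q
    ... | around X eq = contradiction (∷-injectiveˡ eq) a′≢b
    -- If nothing follows `b` in the opened list, then `b` is its end `a`.
    ... | inside X [] eq with _ , _ , _ , _ , _ , [-] ← split X (subst (Path k a′ a) eq path) =
      contradiction refl a≢b
    excise {a} {a′} {b⁻} {b} p q s a≢b a′≢b | Z , r , (k , path) , _ | inside X (z ∷ Y′) eq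
      with _ , _ , _ , p₁ , _ , (_ ∷ p₂) ← split X (subst (Path k a′ a) eq path)
      with refl ← path-head p₂
      -- The entry `z` found after `b` must be the given `b⁺`.
      with refl ← next-functional (Unique-resp-↭ (↭-sym (rotation⇒↭ r)) u)
                    (inside (X ∷ʳ b⁻) Y′ (trans eq (≡.sym (++-assoc X [ b⁻ ] _)))) (carry r s) =
      X ∷ʳ b⁻ , z ∷ Y′ , to-chain p₁ , to-chain p₂ ,
      ↭-trans (↭-sym (shift b (X ∷ʳ b⁻) (z ∷ Y′)))
        (↭-trans (↭-reflexive (trans (++-assoc X [ b⁻ ] _) (≡.sym eq))) (rotation⇒↭ r))

  -- Walks and simple paths inside a set of vertices

  data Walk (Q : V → Set) : V → V → Set where
    [-] : ∀ {x} → Q x → Walk Q x x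
    _∷_ : ∀ {x y z} → Q x × Adj G x z → Walk Q z y → Walk Q x y

  walk-append : ∀ {Q x y z} → Walk Q x y → Walk Q y z → Walk Q x z
  walk-append ([-] _) v = v
  walk-append (s ∷ w) v = s ∷ walk-append w v

  start : ∀ {Q x y} → Walk Q x y → Q x
  start ([-] q)       = q
  start ((q , _) ∷ _) = q

  walk-reverse : ∀ {Q x y} → Walk Q x y → Walk Q y x
  walk-reverse ([-] q) = [-] q
  walk-reverse ((q , e) ∷ w) =
    walk-append (walk-reverse w) ((start w , adj-sym e) ∷ [-] q)

  SimplePath : (V → Set) → V → V → Set
  SimplePath Q x y = ∃ λ l → Path 0 x y l × Unique l × All Q l

  path-suffix : ∀ {Q k x y v l} → k ≡ 0 → Path k x y l → Unique l → All Q l → v ∈ l → SimplePath Q v y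
  path-suffix {Q} {k} {x} {y} {l = l} eq p u q (here refl) with refl ← path-head p =
    l , subst (λ i → Path i x y l) eq p , u , q
  path-suffix eq (_∷_ {j} s p) (_ ∷ u) (_ ∷ q) (there v∈) = path-suffix (m+n≡0⇒n≡0 j eq) p u q v∈

  -- Loop erasure: if the rest of the walk returns to `x`, the part from that visit on replaces it.
  walk⇒simple : ∀ {Q x y} → Walk Q x y → SimplePath Q x y
  walk⇒simple ([-] q) = _ , [-] , [] ∷ [] , q ∷ []
  walk⇒simple {x = x} ((q , e) ∷ w) with walk⇒simple w
  ... | l , p , u , qs with x ∈? l
  ...   | yes x∈ = path-suffix refl p u qs x∈
  ...   | no  x∉ = x ∷ l , edge e ∷ p , All.tabulate (λ v∈ eq → x∉ (subst (_∈ l) (≡.sym eq) v∈)) ∷ u , q ∷ qs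

  reach⇒walk : ∀ {S x y} → Reach G S x y → Walk (_∉ˢ S) x y
  reach⇒walk (here x∉)     = [-] x∉
  reach⇒walk (step x∉ e r) = (x∉ , e) ∷ reach⇒walk r

-- Consequences of 3-connectedness and a first cycle through all heavy vertices

∣∪∣≤ : ∀ {n} (p q : Subset n) → ∣ p ∪ q ∣ ≤ ∣ p ∣ + ∣ q ∣
∣∪∣≤ Vec.[] Vec.[] = z≤n
∣∪∣≤ (outside Vec.∷ p) (outside Vec.∷ q) = ∣∪∣≤ p q
∣∪∣≤ (outside Vec.∷ p) (inside  Vec.∷ q) = ≤-trans (s≤s (∣∪∣≤ p q)) (≤-reflexive (≡.sym (+-suc ∣ p ∣ ∣ q ∣)))
∣∪∣≤ (inside  Vec.∷ p) (outside Vec.∷ q) = s≤s (∣∪∣≤ p q)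
∣∪∣≤ (inside  Vec.∷ p) (inside  Vec.∷ q) = s≤s (≤-trans (∣∪∣≤ p q) (+-monoʳ-≤ ∣ p ∣ (n≤1+n ∣ q ∣)))

module Connectivity {n : ℕ} (G : Graph n) (connected : Connected G 3) where

  open Cycles G public

  walk-map : ∀ {P Q : V → Set} → (∀ {v} → P v → Q v) → ∀ {x y} → Walk P x y → Walk Q x y
  walk-map f ([-] p)       = [-] (f p)
  walk-map f ((p , e) ∷ w) = (f p , e) ∷ walk-map f w

  -- The deleted set has at most two elements; `a` and `b` may coincide, which covers the deletion
  -- of a single vertex.
  walk-avoiding : ∀ a b {x y} → x ≢ a → x ≢ b → y ≢ a → y ≢ b →
                  Walk (λ v → v ≢ a × v ≢ b) x y
  walk-avoiding a b x≢a x≢b y≢a y≢b =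
    walk-map (λ v∉ → (λ { refl → v∉ (x∈p∪q⁺ (inj₁ (x∈⁅x⁆ a))) })
                   , (λ { refl → v∉ (x∈p∪q⁺ (inj₂ (x∈⁅x⁆ b))) }))
      (reach⇒walk (proj₂ connected (⁅ a ⁆ ∪ ⁅ b ⁆) small _ _ (avoid x≢a x≢b) (avoid y≢a y≢b)))
    where
    small : ∣ ⁅ a ⁆ ∪ ⁅ b ⁆ ∣ < 3
    small = s≤s (≤-trans (∣∪∣≤ ⁅ a ⁆ ⁅ b ⁆)
      (≤-reflexive (cong₂ _+_ (∣⁅x⁆∣≡1 a) (∣⁅x⁆∣≡1 b))))
    avoid : ∀ {v} → v ≢ a → v ≢ b → v ∉ˢ ⁅ a ⁆ ∪ ⁅ b ⁆
    avoid v≢a v≢b v∈ with x∈p∪q⁻ ⁅ a ⁆ ⁅ b ⁆ v∈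
    ... | inj₁ v∈a = v≢a (x∈⁅y⁆⇒x≡y a v∈a)
    ... | inj₂ v∈b = v≢b (x∈⁅y⁆⇒x≡y b v∈b)

  member-avoiding : ∀ {l : List V} → Unique l → 3 ≤ length l → ∀ a b → ∃ λ v → v ∈ l × v ≢ a × v ≢ b
  member-avoiding {[]} _ ()
  member-avoiding {_ ∷ []} _ (s≤s ())
  member-avoiding {_ ∷ _ ∷ []} _ (s≤s (s≤s ()))
  member-avoiding {x ∷ y ∷ z ∷ _} ((x≢y ∷ x≢z ∷ _) ∷ (y≢z ∷ _) ∷ _) _ a b
    with x Fin.≟ a | x Fin.≟ b | y Fin.≟ a | y Fin.≟ b
  ... | no p | no q | _ | _ = x , here refl , p , q
  ... | yes refl | _ | _ | no q = y , there (here refl) , x≢y ∘ ≡.sym , q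
  ... | yes refl | _ | _ | yes refl = z , there (there (here refl)) , x≢z ∘ ≡.sym , y≢z ∘ ≡.sym
  ... | no _ | yes refl | no p | _ = y , there (here refl) , p , x≢y ∘ ≡.sym
  ... | no _ | yes refl | yes refl | _ = z , there (there (here refl)) , y≢z ∘ ≡.sym , x≢z ∘ ≡.sym

  vertex-avoiding : ∀ (a b : V) → ∃ λ v → v ≢ a × v ≢ b
  vertex-avoiding a b
    with v , _ , p ← member-avoiding (Unique.allFin⁺ n)
           (≤-trans (n≤1+n 3) (≤-trans (proj₁ connected) (≤-reflexive (≡.sym (length-tabulate {n = n} _))))) a b
    = v , p

  -- The first step of a walk from `a` to a third vertex once `b` is deleted.
  neighbour-avoiding : ∀ {a b} → a ≢ b → ∃ λ p → Adj G a p × p ≢ b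
  neighbour-avoiding {a} {b} a≢b with vertex-avoiding a b
  ... | v , v≢a , v≢b with walk-avoiding b b a≢b a≢b v≢b v≢b
  ... | [-] _ = contradiction refl v≢a
  ... | (_ , e) ∷ [-] (p , _) = _ , e , p
  ... | (_ , e) ∷ (((p , _) , _) ∷ _) = _ , e , p

  neighbour : ∀ a → ∃ (Adj G a)
  neighbour a with b , b≢a , _ ← vertex-avoiding a a
    with p , e , _ ← neighbour-avoiding (b≢a ∘ ≡.sym) = p , e

  -- The walk is stopped where it first meets `c`. Keeping `Q a` is what later tells a new
  -- attachment from those already found.
  attachment : ∀ {Q x y c} → Walk Q x y → x ∉ c → y ∈ c →
               ∃₂ λ z a → Walk (_∉ c) x z × Adj G z a × a ∈ c × Q a
  attachment ([-] _) x∉ y∈ = contradiction y∈ x∉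
  attachment {x = x} {c = c} (_∷_ {z = z} (q , e) w) x∉ y∈ with z ∈? c
  ... | yes z∈ = x , z , [-] x∉ , e , z∈ , start w
  ... | no  z∉ with u , a , v , rest ← attachment w z∉ y∈ = u , a , (x∉ , e) ∷ v , rest

  link⇒≢ : ∀ {x y} → Link x y → x ≢ y
  link⇒≢ {x} (_ , edge e) refl with () ← trans (≡.sym e) (irrefl G x)
  link⇒≢ (_ , jump _ _ x≢y) = x≢y

  -- A cycle through all heavy vertices in the graph obtained from `G` by joining every two of them.
  record HeavyCycle (c : List V) : Set where
    field
      unique : Unique c
      long   : 3 ≤ length c
      heavy  : ∀ {v} → Heavy G v → v ∈ c
      closed : ClosedPath c

  path-end-∈ : ∀ {k x y l} → Path k x y l → y ∈ l
  path-end-∈ [-]     = here refl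
  path-end-∈ (_ ∷ p) = there (path-end-∈ p)

  path-nonempty : ∀ {k x y l} → Path k x y l → 1 ≤ length l
  path-nonempty [-]     = ≤-refl
  path-nonempty (_ ∷ _) = s≤s z≤n

  path-length : ∀ {k x y l} → Path k x y l → x ≢ y → 2 ≤ length l
  path-length [-] x≢y = contradiction refl x≢y
  path-length (_ ∷ [-]) _ = ≤-refl
  path-length (_ ∷ (_ ∷ _)) _ = s≤s (s≤s z≤n)

  -- Any order of the heavy vertices is a path of jumps. The position of `y` is recorded so that the
  -- closing jump has distinct ends.
  heavy-clique-path : ∀ {x z xs} → Unique (x ∷ z ∷ xs) → All (Heavy G) (x ∷ z ∷ xs) →
    ∃₂ λ y k → Path k x y (x ∷ z ∷ xs) × y ∈ z ∷ xs
  heavy-clique-path {xs = []} ((x≢z ∷ _) ∷ _) (hx ∷ hz ∷ _) = _ , _ , jump hx hz x≢z ∷ [-] , here refl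
  heavy-clique-path {xs = _ ∷ _} ((x≢z ∷ _) ∷ u) (hx ∷ h@(hz ∷ _))
    with y , k , p , y∈ ← heavy-clique-path u h = y , _ , jump hx hz x≢z ∷ p , there y∈

  -- A neighbour `p` of `a` other than `b` is joined to `b` by a path avoiding `a`; the edge from
  -- `a` to `p` and the link complete a cycle of at least three vertices.
  cycle-through : ∀ {a b} → Link a b → (∀ {v} → Heavy G v → v ≡ a ⊎ v ≡ b) → ∃ HeavyCycle
  cycle-through {a} {b} s h
    with p , e , p≢b ← neighbour-avoiding (link⇒≢ s)
    with p≢a ← link⇒≢ (link e) ∘ ≡.sym | b≢a ← link⇒≢ s ∘ ≡.sym
    with l , path , u , avoid ← walk⇒simple (walk-avoiding a a p≢a p≢a b≢a b≢a) =
    a ∷ l , record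
      { unique = All.map (λ q → proj₁ q ∘ ≡.sym) avoid ∷ u
      ; long   = s≤s (path-length path p≢b)
      ; heavy  = λ hv → [ (λ { refl → here refl }) , (λ { refl → there (path-end-∈ path) }) ]′ (h hv)
      ; closed = _ , _ , (_ , edge e ∷ path) , link-sym s
      }

  -- Three or more heavy vertices form a cycle of jumps. Fewer are contained in the ends of one
  -- link, chosen as a jump if there are two and as an edge otherwise.
  heavy-cycle : ∃ HeavyCycle
  heavy-cycle = go (filter heavy? (allFin n)) (Unique.filter⁺ heavy? (Unique.allFin⁺ n))
                  (All.tabulate λ v∈ → proj₂ (∈-filter⁻ heavy? {xs = allFin n} v∈))
                  (λ h → ∈-filter⁺ heavy? {xs = allFin n} (∈-allFin _) h)
    where
    some : V
    some = Fin.fromℕ< (≤-trans (s≤s z≤n) (proj₁ connected))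
    go : ∀ l → Unique l → All (Heavy G) l → (∀ {v} → Heavy G v → v ∈ l) → ∃ HeavyCycle
    go [] _ _ h = cycle-through (link (proj₂ (neighbour some))) (λ hv → contradiction (h hv) λ ())
    go (a ∷ []) _ _ h = cycle-through (link (proj₂ (neighbour a))) (λ hv → case₁ (h hv))
      where
      case₁ : ∀ {v b} → v ∈ [ a ] → v ≡ a ⊎ v ≡ b
      case₁ (here eq) = inj₁ eq
    go (a ∷ b ∷ []) ((a≢b ∷ _) ∷ _) (ha ∷ hb ∷ _) h =
      cycle-through (_ , jump ha hb a≢b) (λ hv → case₂ (h hv))
      where
      case₂ : ∀ {v} → v ∈ a ∷ b ∷ [] → v ≡ a ⊎ v ≡ b
      case₂ (here eq) = inj₁ eq
      case₂ (there (here eq)) = inj₂ eq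
    go l@(_ ∷ _ ∷ _ ∷ _) u@(x≢ ∷ _) hs h with y , k , p , y∈ ← heavy-clique-path u hs = l , record
      { unique = u
      ; long   = s≤s (s≤s (s≤s z≤n))
      ; heavy  = h
      ; closed = _ , _ , (_ , p) , (_ , jump (All.lookup hs (there y∈)) (All.lookup hs (here refl))
                                            (All.lookup x≢ y∈ ∘ ≡.sym))
      }

-- Counting in duplicate-free lists, and common neighbours

unique-⊆ : {A : Set} {l m : List A} → Unique l → (∀ {v} → v ∈ l → v ∈ m) → ∃ λ r → l ++ r ↭ m
unique-⊆ {l = []} {m} _ _ = m , ↭-refl
unique-⊆ {l = x ∷ l} {m} (x≢ ∷ u) sub
  with X , Y , refl ← ∈-∃++ (sub (here refl))
  with r , p ← unique-⊆ {m = X ++ Y} u (λ v∈ →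
         tail (All.lookup x≢ v∈ ∘ ≡.sym) (∈-resp-↭ (shift x X Y) (sub (there v∈))))
  = r , ↭-trans (prep x p) (↭-sym (shift x X Y))

module _ {n : ℕ} (G : Graph n) where

  open Cycles G

  count-positive : ∀ f l → 1 ≤ count f l → ∃ λ v → v ∈ l × f v ≡ true
  count-positive f [] ()
  count-positive f (x ∷ l) 1≤ with f x in fx
  ... | true = x , here refl , fx
  ... | false with v , v∈ , fv ← count-positive f l 1≤ = v , there v∈ , fv

  count-two : ∀ f {l} → Unique l → 2 ≤ count f l → ∀ w → ∃ λ v → v ≢ w × f v ≡ true
  count-two f [] ()
  count-two f {x ∷ l} (x≢ ∷ u) 2≤ w with f x in fx
  ... | false = count-two f u 2≤ w
  ... | true with x Fin.≟ w
  ...   | no  x≢w = x , x≢w , fx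
  ...   | yes refl with s≤s 1≤ ← 2≤
                   with v , v∈ , fv ← count-positive f l 1≤ = v , All.lookup x≢ v∈ ∘ ≡.sym , fv

  common-neighbour : ∀ {x y} → 2 ≤ commonNbrs G x y → ∀ w → ∃ λ v → v ≢ w × Adj G x v × Adj G y v
  common-neighbour {x} {y} 2≤ w
    with v , v≢w , eq ← count-two (λ v → E G x v ∧ E G y v) (Unique.allFin⁺ n) 2≤ w
    with true ← E G x v in xv | true ← E G y v in yv = v , v≢w , xv , yv

-- A longest cycle through all heavy vertices

module Longest {n : ℕ} (G : Graph n) (connected : Connected G 3) (1-heavy : OneHeavy G)
  (Z₁ : ∀ a b c d → InducedZ1 G a b c d → PairCond G d b × PairCond G d c)
  {c : List (Fin n)} (hc : Connectivity.HeavyCycle G connected c)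
  (maximal : ∀ {l} → Connectivity.HeavyCycle G connected l → length l ≤ length c)
  where

  open Connectivity G connected
  open HeavyCycle hc

  Outside : V → Set
  Outside v = v ∉ c

  -- The target of all exchanges: such a closed chain contains `c`, hence all heavy vertices, and is
  -- longer than `c`.
  no-extension : ∀ {P x y} → Unique P → All Outside P → 1 ≤ length P →
                 Chain x y (P ++ c) → ¬ Link y x
  no-extension {P} u out 1≤ (k , trail {l} p b) s = <⇒≱ longer (maximal record
    { unique = Unique-resp-↭ (↭-sym b) (Unique.++⁺ u unique λ (v∈P , v∈c) → All.lookup out v∈P v∈c)
    ; long   = ≤-trans long (<⇒≤ longer)
    ; heavy  = λ h → ∈-resp-↭ (↭-sym b) (∈-++⁺ʳ P (heavy h))
    ; closed = _ , _ , (_ , p) , s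
    })
    where
    longer : length c < length l
    longer = ≤-trans (+-monoˡ-≤ (length c) 1≤)
      (≤-reflexive (≡.sym (trans (↭-length b) (length-++ P))))

  outside-light : ∀ {y} → Outside y → ¬ Heavy G y
  outside-light y∉ h = y∉ (heavy h)

  outside≢ : ∀ {y a} → Outside y → a ∈ c → y ≢ a
  outside≢ y∉ a∈ refl = y∉ a∈

  light-link : ∀ {a b} → Link a b → ¬ Heavy G b → Adj G a b
  light-link (_ , edge e) _ = e
  light-link (_ , jump _ hb _) ¬hb = contradiction hb ¬hb

  no-light-claw : ∀ {v a b d} → InducedClaw G v a b d →
                  ¬ Heavy G a → ¬ Heavy G b → ¬ Heavy G d → ∀ {W : Set} → W
  no-light-claw claw ¬a ¬b ¬d with 1-heavy _ _ _ _ claw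
  ... | inj₁ h = contradiction h ¬a
  ... | inj₂ (inj₁ h) = contradiction h ¬b
  ... | inj₂ (inj₂ h) = contradiction h ¬d

  module Oriented (C : Cyclic c) where

    open Cyclic C

    -- Otherwise `a′ … b z … y a … b′`, with one of the two arcs reversed, would be closed by the
    -- link between `a′` and `b′`.
    successors-apart : ∀ {a a′ b b′ y z} → N a a′ → N b b′ → a ≢ b →
                       Walk Outside y z → Adj G a y → Adj G z b → ¬ Link a′ b′
    successors-apart p q a≢b w ay zb s
      with A , B , α , β , σ ← cut₂ p q a≢b (λ { refl → a≢b (injective p q) })
         | P , π , u , out ← walk⇒simple w =
      no-extension u out (path-nonempty π)
        (chain-reorder (↭-trans (shifts A P) (++⁺ˡ P σ))
          (α ⟪ link (adj-sym zb) ⟫ chain-reverse (_ , ⟨ π ⟩) ⟪ link (adj-sym ay) ⟫ chain-reverse β))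
        (link-sym s)

    -- Otherwise the walk could be inserted between `a` and `a′`.
    outside-successor-apart : ∀ {a a′ y z} → N a a′ → Walk Outside y z → Adj G a y → ¬ Link z a′
    outside-successor-apart p w ay s with P , π , u , out ← walk⇒simple w =
      no-extension u out (path-nonempty π)
        (chain-reorder (++-comm c P) (cut p ⟪ link ay ⟫ (_ , ⟨ π ⟩))) s

    heavy-successors : ∀ {a a′ b b′ y z} → N a a′ → N b b′ → a ≢ b →
                       Walk Outside y z → Adj G a y → Adj G z b → Heavy G a′ → ¬ Heavy G b′
    heavy-successors p q a≢b w ay zb h h′ = successors-apart p q a≢b w ay zb
      (_ , jump h h′ λ { refl → a≢b (injective p q) })

    module _ {y : V} (y∉ : Outside y) where

      private
        yy : Walk Outside y y
        yy = [-] y∉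

      -- A link from `b⁻` to `b⁺` would allow `b` to be taken out and reinserted after `y` between
      -- `a` and `a′`, giving `a′ … b⁻ b⁺ … a y b`.
      exchange : ∀ {a a′ b⁻ b b⁺} → N a a′ → N b⁻ b → N b b⁺ → a ≢ b →
                 Adj G a y → Adj G b y → Adj G b a′ → ¬ Link b⁻ b⁺
      exchange {b = b} p q r a≢b ay by ba′ s
        with A , B , α , β , σ ← excise p q r a≢b
               -- If `a′` were `b`, then `y` would be adjacent to the successor of its neighbour
               -- `a`.
               (λ { refl → outside-successor-apart p yy ay (link (adj-sym by)) }) =
        no-extension ([] ∷ []) (y∉ ∷ []) ≤-refl
          (chain-reorder (↭-trans (↭-reflexive (≡.sym (++-assoc A B _)))
              (↭-trans (++-comm (A ++ B) _) (prep y σ)))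
            (α ⟪ s ⟫ β ⟪ link ay ⟫ single {y} ⟪ link (adj-sym by) ⟫ single {b}))
          (link ba′)

      -- Since `y` and `a′` are light, the pair condition must provide a second common neighbour
      -- `b`, and a claw centred at `b` forces its successor to be heavy.
      heavy-next : ∀ {a a′} → N a a′ → Adj G a y → ¬ Heavy G a′ → PairCond G y a′ →
        ∃₂ λ b b′ → b ≢ a × Adj G b y × Adj G b a′ × N b b′ × Heavy G b′
      heavy-next p ay ¬h (inj₁ (inj₁ h)) = contradiction h (outside-light y∉)
      heavy-next p ay ¬h (inj₁ (inj₂ h)) = contradiction h ¬h
      heavy-next {a} {a′} p ay ¬h (inj₂ 2≤)
        with b , b≢a , yb , a′b ← common-neighbour G 2≤ a
        with b ∈? c
      -- Outside `c`, the walk from `y` to `b` would fit between `a` and `a′`.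
      ... | no b∉ = contradiction (link (adj-sym a′b))
                      (outside-successor-apart p ((y∉ , yb) ∷ [-] b∉) ay)
      ... | yes b∈ with next b∈
      ... | b′ , q with heavy? b′
      ... | yes h = b , b′ , b≢a , adj-sym yb , adj-sym a′b , q , h
      -- The ends `a′`, `y`, `b′` are all light, and any edge among them would lengthen the cycle.
      ... | no ¬h′ = no-light-claw
        ( adj-sym a′b , adj-sym yb , light-link (linked q) ¬h′
        , outside≢ y∉ (target-∈ p) ∘ ≡.sym , (λ { refl → b≢a (injective q p) }) , outside≢ y∉ (target-∈ q)
        , outside-successor-apart p yy ay ∘ link ∘ adj-sym
        , successors-apart p q (b≢a ∘ ≡.sym) yy ay yb ∘ link
        , outside-successor-apart q yy (adj-sym yb) ∘ link)
        ¬h (outside-light y∉) ¬h′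

  module Light {y w : V} (y∉ : Outside y) (wy : Adj G w y) (C : Cyclic c) where

    open Cyclic C
    open Oriented C
    private module Opposite = Oriented (opposite C)

    private
      yy : Walk Outside y y
      yy = [-] y∉

    module _ {w⁻ w⁺} (p : N w w⁺) (q : N w⁻ w) (light⁺ : ¬ Heavy G w⁺) (light⁻ : ¬ Heavy G w⁻) where

      y≁w⁺ : ¬ Adj G y w⁺
      y≁w⁺ = outside-successor-apart p yy wy ∘ link

      y≁w⁻ : ¬ Adj G y w⁻
      y≁w⁻ = Opposite.outside-successor-apart q yy wy ∘ link

      w~w⁺ : Adj G w w⁺
      w~w⁺ = light-link (linked p) light⁺

      w~w⁻ : Adj G w w⁻
      w~w⁻ = light-link (link-sym (linked q)) light⁻

      w⁺~w⁻ : Adj G w⁺ w⁻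
      w⁺~w⁻ with adj? w⁺ w⁻
      ... | yes e = e
      ... | no ¬e = no-light-claw
        ( wy , w~w⁺ , w~w⁻
        , outside≢ y∉ (target-∈ p) , outside≢ y∉ (source-∈ q) , (λ { refl → asym p q })
        , y≁w⁺ , y≁w⁻ , ¬e)
        (outside-light y∉) light⁺ light⁻

      -- The vertex `j` of the overview. The field `pair` is kept so that `heavy-next` can be
      -- applied to `j⁻` in the reversed orientation.
      record Partner : Set where
        field
          {j j⁺ j⁻} : V
          j≢w      : j ≢ w
          jy       : Adj G j y
          jw⁺      : Adj G j w⁺
          p′       : N j j⁺
          heavy⁺   : Heavy G j⁺
          q′       : N j⁻ j
          light    : ¬ Heavy G j⁻
          pair     : PairCond G y j⁻

      partner : Partner
      partner with heavy-next y∉ p wy light⁺ (proj₁ (Z₁ w w⁺ w⁻ y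
                     (w~w⁺ , w⁺~w⁻ , w~w⁻ , adj-sym wy , y≁w⁺ , y≁w⁻)))
      ... | j , j⁺ , j≢w , jy , jw⁺ , p′ , heavy⁺ with prev (source-∈ p′)
      ... | j⁻ , q′ = record
        { j≢w = j≢w ; jy = jy ; jw⁺ = jw⁺ ; p′ = p′ ; heavy⁺ = heavy⁺ ; q′ = q′ ; light = light
        -- The triangle on `j`, `w⁺`, `j⁻` with pendant vertex `y` at `j`.
        ; pair = proj₂ (Z₁ j w⁺ j⁻ y (jw⁺ , w⁺~j⁻ , j~j⁻ , adj-sym jy , y≁w⁺ , y≁j⁻))
        }
        where
        light : ¬ Heavy G j⁻
        -- A heavy `j⁻` would be linked to the heavy `j⁺`, bridging the gap left by moving `j` next
        -- to `w⁺`.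
        light h = exchange y∉ p q′ p′ (j≢w ∘ ≡.sym) wy jy jw⁺
          (_ , jump h heavy⁺ λ { refl → asym p′ q′ })
        j~j⁻ : Adj G j j⁻
        j~j⁻ = light-link (link-sym (linked q′)) light
        y≁j⁻ : ¬ Adj G y j⁻
        y≁j⁻ = Opposite.outside-successor-apart q′ yy jy ∘ link
        w⁺~j⁻ : Adj G w⁺ j⁻
        w⁺~j⁻ with adj? w⁺ j⁻
        ... | yes e = e
        ... | no ¬e = no-light-claw
          ( jw⁺ , jy , j~j⁻
          , outside≢ y∉ (target-∈ p) ∘ ≡.sym
          -- If `w⁺` were `j⁻`, its edge to `w⁻` would link the predecessors of the two attachments
          -- `w` and `j`.
          , (λ { refl → Opposite.successors-apart q q′ (j≢w ∘ ≡.sym) yy wy (adj-sym jy)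
                          (link (adj-sym w⁺~w⁻)) })
          , outside≢ y∉ (source-∈ q′)
          , y≁w⁺ ∘ adj-sym , ¬e , y≁j⁻)
          light⁺ (outside-light y∉) light

  no-light-attachment : ∀ {y w} → Outside y → Adj G w y → (C : Cyclic c) → let open Cyclic C in
    ∀ {w⁺ w⁻} → N w w⁺ → N w⁻ w → ¬ Heavy G w⁺ → ¬ Heavy G w⁻ → ∀ {W : Set} → W
  no-light-attachment {y} {w} y∉ wy C {w⁺} p q light⁺ light⁻ = go (heavy-next y∉ L.q′ L.jy L.light L.pair)
    where
    open Cyclic C
    open Oriented C
    module J = Light.Partner (Light.partner y∉ wy C p q light⁺ light⁻)
    -- In this mirrored copy the signs swap: `L.j⁻` is the light vertex after `L.j` in the
    -- orientation of `C`, and `L.j⁺` the heavy one before it.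
    module L = Light.Partner (Light.partner y∉ wy (opposite C) q p light⁻ light⁺)
    yy : Walk Outside y y
    yy = [-] y∉
    go : (∃₂ λ b b′ → b ≢ L.j × Adj G b y × Adj G b L.j⁻ × N b b′ × Heavy G b′) → ∀ {W : Set} → W
    go (m , m⁺ , m≢l , my , ml⁺ , pm , hm) with m Fin.≟ J.j
    -- Two distinct attachments would both have heavy successors.
    ... | no m≢j = contradiction J.heavy⁺ (heavy-successors pm J.p′ m≢j yy my (adj-sym J.jy) hm)
    ... | yes refl = no-light-claw
      ( J.jw⁺ , ml⁺ , my
      , (λ eq → L.j≢w (injective L.q′ (subst (N w) eq p))) , outside≢ y∉ (target-∈ p) ∘ ≡.sym
      , outside≢ y∉ (target-∈ L.q′) ∘ ≡.sym
      , successors-apart p L.q′ (L.j≢w ∘ ≡.sym) yy wy (adj-sym L.jy) ∘ link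
      , outside-successor-apart p yy wy ∘ link ∘ adj-sym
      , outside-successor-apart L.q′ yy L.jy ∘ link ∘ adj-sym)
      light⁺ L.light (outside-light y∉)

  spanning : ∀ v → v ∈ c
  spanning y with y ∈? c
  ... | yes y∈ = y∈
  ... | no y∉ = three-attachments
    where
    C : Cyclic c
    C = cyclic long unique closed
    open Cyclic C
    module Forward = Oriented C
    module Backward = Oriented (opposite C)

    Attached : V → Set
    Attached a = ∃ λ z → Walk Outside y z × Adj G z a × a ∈ c

    -- After deleting `a` and `b`, a walk still leads from `y` to a remaining vertex of `c`; it
    -- first meets `c` at an attachment different from both.
    another : ∀ {a b} → a ∈ c → b ∈ c → ∃ λ d → Attached d × d ≢ a × d ≢ b
    another {a} {b} a∈ b∈ with v , v∈ , v≢a , v≢b ← member-avoiding unique long a b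
      with z , d , w , zd , d∈ , d≢ ←
        attachment (walk-avoiding a b (outside≢ y∉ a∈) (outside≢ y∉ b∈) v≢a v≢b) y∉ v∈
      = d , (z , w , zd , d∈) , d≢

    end : ∀ {Q x z} → Walk Q x z → Q z
    end = start ∘ walk-reverse

    one-heavy-next : ∀ {a b a′ b′} → Attached a → Attached b → a ≢ b → N a a′ → N b b′ →
                     Heavy G a′ → ¬ Heavy G b′
    one-heavy-next (_ , w , za , _) (_ , w′ , zb , _) a≢b p q =
      Forward.heavy-successors p q a≢b (walk-append (walk-reverse w) w′) (adj-sym za) zb

    one-heavy-prev : ∀ {a b a′ b′} → Attached a → Attached b → a ≢ b → N a′ a → N b′ b →
                     Heavy G a′ → ¬ Heavy G b′
    one-heavy-prev (_ , w , za , _) (_ , w′ , zb , _) a≢b p q =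
      Backward.heavy-successors p q a≢b (walk-append (walk-reverse w) w′) (adj-sym za) zb

    -- The role of `y` passes to the outside vertex at the end of the walk, which is adjacent to
    -- `a`.
    light-impossible : ∀ {a a⁺ a⁻} → Attached a → N a a⁺ → N a⁻ a → ¬ Heavy G a⁺ → ¬ Heavy G a⁻ →
                       ∀ {W : Set} → W
    light-impossible (_ , w , za , _) p q = no-light-attachment (end w) (adj-sym za) C p q

    -- At most one of the three attachments has a heavy successor and at most one
    -- a heavy predecessor.
    three-attachments : y ∈ c
    three-attachments
      with v , v∈ , _ ← member-avoiding unique long y y
      with a , A@(_ , _ , _ , a∈) , _ ← another v∈ v∈
      with b , B@(_ , _ , _ , b∈) , b≢a , _ ← another a∈ a∈
      with d , D@(_ , _ , _ , d∈) , d≢a , d≢b ← another a∈ b∈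
      with a⁺ , pa ← next a∈ | a⁻ , qa ← prev a∈
         | b⁺ , pb ← next b∈ | b⁻ , qb ← prev b∈
         | d⁺ , pd ← next d∈ | d⁻ , qd ← prev d∈
      with heavy? a⁺ | heavy? a⁻ | heavy? b⁺ | heavy? b⁻
    ... | no ¬a⁺ | no ¬a⁻ | _ | _ = light-impossible A pa qa ¬a⁺ ¬a⁻
    ... | _ | _ | no ¬b⁺ | no ¬b⁻ = light-impossible B pb qb ¬b⁺ ¬b⁻
    ... | yes ha⁺ | _ | yes hb⁺ | _ =
      contradiction hb⁺ (one-heavy-next A B (b≢a ∘ ≡.sym) pa pb ha⁺)
    ... | _ | yes ha⁻ | _ | yes hb⁻ =
      contradiction hb⁻ (one-heavy-prev A B (b≢a ∘ ≡.sym) qa qb ha⁻)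
    -- Here `a` and `b` account for the only heavy successor and the only heavy predecessor, so both
    -- cycle neighbours of `d` are light.
    ... | yes ha⁺ | no _ | no _ | yes hb⁻ = light-impossible D pd qd
      (one-heavy-next A D (d≢a ∘ ≡.sym) pa pd ha⁺) (one-heavy-prev B D (d≢b ∘ ≡.sym) qb qd hb⁻)
    ... | no _ | yes ha⁻ | yes hb⁺ | no _ = light-impossible D pd qd
      (one-heavy-next B D (d≢b ∘ ≡.sym) pb pd hb⁺) (one-heavy-prev A D (d≢a ∘ ≡.sym) qa qd ha⁻)

-- Hamiltonian cycles as maps, and their decidability

lookup-injective : {A : Set} {l : List A} → Unique l → ∀ i j → lookup l i ≡ lookup l j → i ≡ j
lookup-injective (_ ∷ _) Fin.zero Fin.zero _ = refl
lookup-injective {l = x ∷ l} (x≢ ∷ _) Fin.zero (Fin.suc j) eq =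
  contradiction eq (All.lookup x≢ (∈-lookup j))
lookup-injective {l = x ∷ l} (x≢ ∷ _) (Fin.suc i) Fin.zero eq =
  contradiction (≡.sym eq) (All.lookup x≢ (∈-lookup i))
lookup-injective (_ ∷ u) (Fin.suc i) (Fin.suc j) eq = cong Fin.suc (lookup-injective u i j eq)

any-vec? : ∀ {n m} {P : Vec (Fin n) m → Set} → (∀ v → Dec (P v)) → Dec (∃ P)
any-vec? {m = zero}  P? = map′ ([] ,_) (λ { ([] , p) → p }) (P? [])
any-vec? {m = suc m} P? = map′ (λ (x , v , p) → x ∷ v , p) (λ { (x ∷ v , p) → x , v , p })
  (any? λ x → any-vec? λ v → P? (x ∷ v))

module _ {n : ℕ} (G : Graph n) where

  open Cycles G

  IsHamiltonian : (Fin n → Fin n) → Set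
  IsHamiltonian σ = Injective _≡_ _≡_ σ ×
    (∀ i j → toℕ j ≡ suc (toℕ i) → Adj G (σ i) (σ j)) ×
    (∀ i j → toℕ i ≡ 0 → suc (toℕ j) ≡ n → Adj G (σ j) (σ i))

  IsHamiltonian-resp : ∀ {σ τ} → (∀ i → σ i ≡ τ i) → IsHamiltonian σ → IsHamiltonian τ
  IsHamiltonian-resp eq (inj , adj , close) =
    (λ {i} {j} e → inj (trans (eq i) (trans e (≡.sym (eq j))))) ,
    (λ i j e → subst₂ (Adj G) (eq i) (eq j) (adj i j e)) ,
    (λ i j e e′ → subst₂ (Adj G) (eq j) (eq i) (close i j e e′))

  isHamiltonian? : ∀ σ → Dec (IsHamiltonian σ)
  isHamiltonian? σ =
    map′ (λ f {i} {j} → f i j) (λ f i j → f) (all? λ i → all? λ j → (σ i Fin.≟ σ j) →-dec (i Fin.≟ j)) ×-dec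
    (all? λ i → all? λ j → (toℕ j ≟ suc (toℕ i)) →-dec adj? _ _) ×-dec
    (all? λ i → all? λ j → (toℕ i ≟ 0) →-dec (suc (toℕ j) ≟ n) →-dec adj? _ _)

  -- A finite search over vectors of values. A map agrees with its tabulation only pointwise, hence
  -- the transport by `IsHamiltonian-resp`. Decidability is what permits the final argument by
  -- contradiction.
  hamiltonian? : Dec (Hamiltonian G)
  hamiltonian? = map′ (λ (v , p) → Vec.lookup v , p)
    (λ (σ , p) → Vec.tabulate σ , IsHamiltonian-resp (λ i → ≡.sym (lookup∘tabulate σ i)) p)
    (any-vec? λ v → isHamiltonian? (Vec.lookup v))

  path-step : ∀ {k x y l} → k ≡ 0 → Path k x y l → ∀ i j → toℕ j ≡ suc (toℕ i) → Adj G (lookup l i) (lookup l j)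
  path-step _ [-] Fin.zero Fin.zero ()
  path-step _ (edge e ∷ [-]) Fin.zero (Fin.suc Fin.zero) _ = e
  path-step _ (edge e ∷ (_ ∷ _)) Fin.zero (Fin.suc Fin.zero) _ = e
  path-step _ (_ ∷ _) Fin.zero Fin.zero ()
  path-step _ (_ ∷ [-]) Fin.zero (Fin.suc (Fin.suc ()))
  path-step _ (_ ∷ (_ ∷ _)) Fin.zero (Fin.suc (Fin.suc _)) ()
  path-step eq (_∷_ {j} s p) (Fin.suc i) (Fin.suc i′) e =
    path-step (m+n≡0⇒n≡0 j eq) p i i′ (suc-injective e)

  path-first : ∀ {k x y l} → Path k x y l → ∀ i → toℕ i ≡ 0 → lookup l i ≡ x
  path-first [-]     Fin.zero _ = refl
  path-first (_ ∷ _) Fin.zero _ = refl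

  path-final : ∀ {k x y l} → Path k x y l → ∀ i → suc (toℕ i) ≡ length l → lookup l i ≡ y
  path-final [-] Fin.zero _ = refl
  path-final (_ ∷ [-]) Fin.zero ()
  path-final (_ ∷ (_ ∷ _)) Fin.zero ()
  path-final (_ ∷ p) (Fin.suc i) eq = path-final p i (suc-injective eq)

  path-cycle⇒hamiltonian : HamiltonianPathCycle → Hamiltonian G
  path-cycle⇒hamiltonian (x , y , trail {l} p b , e) = (λ i → lookup l (cast n≡ i)) ,
    (λ {i} {j} eq → toℕ-injective (trans (≡.sym (toℕ-cast n≡ i))
      (trans (cong toℕ (lookup-injective u (cast n≡ i) (cast n≡ j) eq)) (toℕ-cast n≡ j)))) ,
    (λ i j eq → path-step refl p (cast n≡ i) (cast n≡ j)
      (trans (toℕ-cast n≡ j) (trans eq (cong suc (≡.sym (toℕ-cast n≡ i)))))) ,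
    (λ i j eq eq′ → subst₂ (Adj G)
      (≡.sym (path-final p (cast n≡ j) (trans (cong suc (toℕ-cast n≡ j)) (trans eq′ n≡))))
      (≡.sym (path-first p (cast n≡ i) (trans (toℕ-cast n≡ i) eq))) e)
    where
    n≡ : n ≡ length l
    n≡ = ≡.sym (trans (↭-length b) (length-tabulate {n = n} _))
    u : Unique l
    u = Unique-resp-↭ (↭-sym b) (Unique.allFin⁺ n)

-- Reduction to a longest cycle

unique-length≤ : ∀ {n} {l : List (Fin n)} → Unique l → length l ≤ n
unique-length≤ {n} {l} u with r , p ← unique-⊆ {m = allFin n} u (λ _ → ∈-allFin _) =
  ≤-trans (m≤m+n (length l) (length r))
    (≤-reflexive (trans (≡.sym (length-++ l)) (trans (↭-length p) (length-tabulate {n = n} _))))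

unique-spanning : ∀ {n} {l : List (Fin n)} → Unique l → (∀ v → v ∈ l) → l ↭ allFin n
unique-spanning {n} {l} u all∈ with unique-⊆ u (λ _ → ∈-allFin _)
... | [] , p = subst (_↭ allFin n) (++-identityʳ l) p
... | v ∷ r , p = contradiction (∈-++⁺ˡ (all∈ v))
  (head∉tail (Unique-resp-↭ (shift v l r) (Unique-resp-↭ (↭-sym p) (Unique.allFin⁺ n))))

theorem11 : (n : ℕ) → (G : Graph n) → 3 ≤ n → Connected G 3 → OneHeavy G →
    (∀ a b c d → InducedZ1 G a b c d → PairCond G d b × PairCond G d c) →
    Hamiltonian G
theorem11 n G _ connected 1-heavy Z₁ = decidable-stable (hamiltonian? G) λ ¬H →
  let c , hc = heavy-cycle
  in  descend ¬H n hc (m≤n+m n (length c))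
  where
  open Connectivity G connected
  -- The number `m` bounds how many vertices `c` can miss. A longer heavy cycle has a smaller bound
  -- and is refuted by recursion, so `c` is longest and therefore spanning; removing its jumps
  -- contradicts `¬H`.
  descend : ¬ Hamiltonian G → ∀ m {c} → HeavyCycle c → n ≤ length c + m → ⊥
  descend ¬H m {c} hc n≤ with _ , _ , (_ , path) , closing ← HeavyCycle.closed hc =
    ¬H (path-cycle⇒hamiltonian G (hamiltonian-closure (trail path spans) (proj₂ closing)))
    where
    maximal : ∀ m → n ≤ length c + m → ∀ {l} → HeavyCycle l → length l ≤ length c
    -- With bound zero `c` already has `n` entries, the most that a duplicate-free list allows.
    maximal zero n≤ hl = ≤-trans (unique-length≤ (HeavyCycle.unique hl))
      (≤-trans n≤ (≤-reflexive (+-identityʳ (length c))))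
    maximal (suc m) n≤ {l} hl = ≮⇒≥ λ c<l → descend ¬H m hl (≤-trans n≤
      (≤-trans (≤-reflexive (+-suc (length c) m)) (+-monoˡ-≤ m c<l)))
    spans : c ↭ allFin n
    spans = unique-spanning (HeavyCycle.unique hc)
      (Longest.spanning G connected 1-heavy Z₁ hc (maximal m n≤))
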